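{- If a correlation-free cellular automaton (CFCA) is number-conserving, then it is a deterministic map.
   Context: A (one-dimensional) stochastic cellular automaton is a tuple $(Q,R,V,V',f)$ where $Q$ (states) and $R$ (random symbols) are finite sets, $V=\{v_1,\dots,v_\rho\}$ and $V'=\{v'_1,\dots,v'_{\rho'}\}$ are finite subsets of $\mathbb{Z}$, and $f:Q^\rho\times R^{\rho'}\to Q$. It is a CFCA if $V'=\{0\}$. Its explicit global function is $F:Q^{\mathbb{Z}}\times R^{\mathbb{Z}}\to Q^{\mathbb{Z}}$, $F(c,s)_z=f\big((c_{z+v_j})_j,(s_{z+v'_j})_j\big)$. For $c\in Q^{\mathbb{Z}}$, $\mathcal{S}_F(c)$ is the law of $F(c,s)$ when $s$ is drawn from the uniform (i.i.d. uniform product) measure on $R^{\mathbb{Z}}$. The automaton is deterministic if $f$ does not depend on its second argument (the random symbols). A configuration is finite if it has finitely many cells in a state other than $0$. A stochastic CA $F$ is number-conserving if $Q=\{0,\dots,q\}$ for some $q\in\mathbb{N}$ and for every finite configuration $c\in Q^{\mathbb{Z}}$, $\big(\mathcal{S}_F(c)\big)(\{c':\sum_i c'_i=\sum_i c_i\})=1$, where the sums range over all of $\mathbb{Z}$ and only finite configurations $c'$ are considered. -}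

module Defs where

open import Data.Fin using (Fin; zero; toℕ)
open import Data.Integer using (ℤ; 0ℤ; 1ℤ) renaming (_+_ to _+ᶻ_)
open import Data.List using (List; []; _∷_; [_]; length; map; sum)
open import Data.List.Membership.Propositional using () renaming (_∈_ to _∈ˡ_)
open import Data.List.Relation.Unary.All using (All)
open import Data.List.Relation.Unary.Unique.Propositional using (Unique)
open import Data.Maybe using (Maybe; maybe′)
import Data.Maybe.Relation.Unary.Any as Maybe
open import Data.Nat using (ℕ; zero; suc; _^_; NonZero) renaming (_≤_ to _≤ⁿ_)
open import Data.Nat.Properties using (m^n≢0)
open import Data.Product using (_×_; _,_; Σ; ∃; proj₁)
open import Data.Rational using (ℚ; 0ℚ; _+_; _-_; _/_; ∣_∣; _≤_; _<_)
open import Data.Vec using (Vec; fromList) renaming (map to mapᵛ)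
open import Function using (_∘_)
open import Relation.Binary.PropositionalEquality using (_≡_; _≢_)
open import Relation.Unary using (Pred; ∁; _⊆_; _⊢_; ⋃)
open import Level using (0ℓ)

-- Q^ℤ or R^ℤ, for a finite alphabet identified with {0, …, n-1}.
Config : ℕ → Set
Config n = ℤ → Fin n

-- n states, m random symbols.  The finite sets V and V′ of integers are
-- given by duplicate-free enumerations v₁, …, v_ρ and v′₁, …, v′_ρ′.
record SCA (n m : ℕ) : Set where
  field
    V         : List ℤ
    V-unique  : Unique V
    V′        : List ℤ
    V′-unique : Unique V′
    f         : Vec (Fin n) (length V) → Vec (Fin m) (length V′) → Fin n

  F : Config n → Config m → Config n
  F c s z = f (mapᵛ (λ v → c (z +ᶻ v)) (fromList V))
              (mapᵛ (λ v → s (z +ᶻ v)) (fromList V′))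

IsCFCA : ∀ {n m} → SCA n m → Set
IsCFCA A = SCA.V′ A ≡ [ 0ℤ ]

Deterministic : ∀ {n m} → SCA n m → Set
Deterministic A = ∀ x r r′ → f x r ≡ f x r′
  where open SCA A

-- The i.i.d. uniform product measure on (Fin m)^ℤ.

-- The set of all s with s z ≡ a for each of the listed constraints (z , a);
-- the constrained cells are pairwise distinct.
record Cylinder (m : ℕ) : Set where
  field
    constraints : List (ℤ × Fin m)
    distinct    : Unique (map proj₁ constraints)

⟦_⟧ : ∀ {m} → Cylinder m → Pred (Config m) 0ℓ
⟦ C ⟧ s = All (λ (z , a) → s z ≡ a) (Cylinder.constraints C)

μ : ∀ {m} .{{_ : NonZero m}} → Cylinder m → ℚ
μ {m} C = _/_ 1ℤ (m ^ k) {{m^n≢0 m k}}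
  where k = length (Cylinder.constraints C)

partialSum : (ℕ → ℚ) → ℕ → ℚ
partialSum a zero    = 0ℚ
partialSum a (suc k) = partialSum a k + a k

Cauchy : (ℕ → ℚ) → Set
Cauchy S = ∀ δ → 0ℚ < δ → ∃ λ N → ∀ i j → N ≤ⁿ i → N ≤ⁿ j → ∣ S i - S j ∣ ≤ δ

-- A set is null when for every ε > 0 it has a countable cover by cylinders of
-- total measure at most ε.  The entry `nothing` of a cover is the empty set.
-- Classically the Cauchy condition is automatic, the partial sums being
-- nondecreasing and bounded by ε.  It is needed constructively: without it,
-- in recursive models, the whole space is null as soon as m ≥ 2.
Null : ∀ {m} .{{_ : NonZero m}} → Pred (Config m) 0ℓ → Set
Null {m} E = ∀ ε → 0ℚ < ε →
  Σ (ℕ → Maybe (Cylinder m)) λ U →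
    let S = partialSum (maybe′ μ 0ℚ ∘ U) in
    Cauchy S × (∀ k → S k ≤ ε) × E ⊆ ⋃ ℕ (λ k s → Maybe.Any (λ C → ⟦ C ⟧ s) (U k))

AlmostSure : ∀ {m} .{{_ : NonZero m}} → Pred (Config m) 0ℓ → Set
AlmostSure E = Null (∁ E)

-- (𝒮_F(c))(E) = 1, where 𝒮_F(c) is the image of the uniform measure under F(c, ·).
Law-certain : ∀ {n m} .{{_ : NonZero m}} → SCA n m → Config n → Pred (Config n) 0ℓ → Set
Law-certain A c E = AlmostSure (SCA.F A c ⊢ E)

-- A duplicate-free list of cells containing all the cells in a state other than 0.
Finite : ∀ {q} → Config (suc q) → Set
Finite c = Σ (List ℤ) λ L → Unique L × (∀ z → c z ≢ zero → z ∈ˡ L)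

-- Σ_{z ∈ ℤ} c z; the value does not depend on the chosen list of cells.
total : ∀ {q} (c : Config (suc q)) → Finite c → ℕ
total c (L , _) = sum (map (toℕ ∘ c) L)

NumberConserving : ∀ {q m} .{{_ : NonZero m}} → SCA (suc q) m → Set
NumberConserving A = ∀ c (fin : Finite c) →
  Law-certain A c (λ c′ → Σ (Finite c′) λ fin′ → total c′ fin′ ≡ total c fin)

{-# OPTIONS --safe #-}
module Submission where

-- Suppose that f x a and f x b differ, and let c be the finite configuration
-- that shows the pattern x around cell 0 and is 0 elsewhere.  If s and s′ are
-- random configurations which differ at cell 0 only, where they carry a and b,
-- then F c s and F c s′ differ at cell 0 only, because each cell sees no
-- random symbol but its own.  So their totals differ (total-determines), and
-- they cannot both be equal to the total of c.  It remains to find such a pair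
-- for which conservation does hold on both sides.  Since each of a and b is
-- drawn at cell 0 with probability 1/m, almost every pair will do.
--
-- Constructively, a point outside a null set has to be built (Null-avoid).
-- Take a cover of the exceptional set of total measure at most 1/(4m).  The
-- expected number of sets of the cover that contain s, plus the expected
-- number of those that contain s′, is then at most 1/2.  The symbols of s are
-- chosen one cell at a time so that this expectation, conditioned on the
-- symbols chosen so far, stays below 1.  Such a choice exists since the
-- expectation is the average over the m possible symbols (weight-average);
-- it can be made effectively since the measures of the cover have Cauchy
-- partial sums, so that all but finitely many terms are negligible
-- (Light-branch).  If s or s′ were in a set of the cover, that set would
-- contribute 1 to the expectation once all the cells that it constrains are
-- assigned.  This only refutes membership in the exceptional set, so
-- conservation is known up to double negation, which suffices because
-- equality of states is decidable.

open import Defs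
open import Data.Bool using (true; false; if_then_else_)
open import Data.Fin using (Fin; zero; suc; toℕ)
import Data.Fin.Properties as Fin
open import Data.Integer using (ℤ; +_; -[1+_]; 0ℤ; 1ℤ) renaming (_+_ to _+ᶻ_; _*_ to _*ᶻ_; _≟_ to _≟ᶻ_)
import Data.Integer.Properties as ℤ
open import Data.List using (List; []; _∷_; _++_; length; map; filter; deduplicate)
open import Data.List.Membership.Propositional using (_∈_)
open import Data.List.Membership.Propositional.Properties
  using (∈-filter⁺; ∈-filter⁻; ∈-deduplicate⁺; ∈-++⁺ˡ; ∈-++⁺ʳ)
open import Data.List.Membership.Propositional.Properties.WithK using (unique∧set⇒bag)
open import Data.List.Properties using (map-cong-local)
open import Data.List.Relation.Binary.BagAndSetEquality using (∼bag⇒↭)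
open import Data.List.Relation.Binary.Permutation.Propositional.Properties using (map⁺)
open import Data.List.Relation.Unary.All as All using (All; []; _∷_)
open import Data.List.Relation.Unary.AllPairs using ([]; _∷_)
open import Data.List.Relation.Unary.Any using (here; there)
open import Data.List.Relation.Unary.Unique.Propositional using (Unique)
import Data.List.Relation.Unary.Unique.Propositional.Properties as Unique
open import Data.List.Relation.Unary.Unique.DecPropositional.Properties _≟ᶻ_ using (deduplicate-!)
open import Data.Maybe using (Maybe; just; nothing; maybe′)
import Data.Maybe.Relation.Unary.Any as Maybe
open import Data.Nat as ℕ using (ℕ; zero; suc; _^_; NonZero)
open import Data.Nat.ListAction using (sum)
open import Data.Nat.ListAction.Properties using (sum-↭)
import Data.Nat.Properties as ℕ
open import Data.Product using (_×_; _,_; ∃; proj₁; proj₂)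
open import Data.Rational
  using (ℚ; 0ℚ; 1ℚ; ½; _+_; _*_; _-_; -_; _/_; ∣_∣; _≤_; _<_; _≤?_; nonNegative; positive; toℚᵘ)
open import Data.Rational.Properties
import Data.Rational.Unnormalised as ℚᵘ
import Data.Rational.Unnormalised.Properties as ℚᵘ
open import Data.Rational.Solver using (module +-*-Solver)
open import Data.Sum using (inj₁; inj₂)
open import Data.Vec using (Vec; []; _∷_; fromList) renaming (map to mapᵛ)
open import Data.Vec.Properties using (map-cong)
open import Algebra.Bundles using (CommutativeRing)
open import Algebra.Properties.Semiring.Sum (CommutativeRing.semiring +-*-commutativeRing)
  using (sum-cong-≗; ∑-distrib-+; *-distribˡ-sum; *-distribʳ-sum) renaming (sum to ∑)
open import Function using (_∘_; const; it; mk⇔)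
open import Relation.Binary.PropositionalEquality
open import Relation.Nullary using (¬_; does; yes; no; ¬?; contradiction)
open import Relation.Nullary.Decidable using (dec-true; dec-false; decidable-stable)
open import Relation.Unary using (Pred; Decidable)
open import Level using (0ℓ)

-- Finite sums of rationals

∑-nonneg : ∀ {n} {v : Fin n → ℚ} → (∀ a → 0ℚ ≤ v a) → 0ℚ ≤ ∑ v
∑-nonneg {zero}  0≤v = ≤-refl
∑-nonneg {suc n} 0≤v = +-mono-≤ (0≤v zero) (∑-nonneg (0≤v ∘ suc))

∑-mono-≤ : ∀ {n} {v w : Fin n → ℚ} → (∀ a → v a ≤ w a) → ∑ v ≤ ∑ w
∑-mono-≤ {zero}  v≤w = ≤-refl
∑-mono-≤ {suc n} v≤w = +-mono-≤ (v≤w zero) (∑-mono-≤ (v≤w ∘ suc))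

p≤p+q : ∀ {p q} → 0ℚ ≤ q → p ≤ p + q
p≤p+q {p} {q} 0≤q = begin
  p       ≡⟨ +-identityʳ p ⟨
  p + 0ℚ  ≤⟨ +-monoʳ-≤ p 0≤q ⟩
  p + q   ∎
  where open ≤-Reasoning

p≤q+p : ∀ {p q} → 0ℚ ≤ q → p ≤ q + p
p≤q+p {p} {q} 0≤q = ≤-trans (p≤p+q 0≤q) (≤-reflexive (+-comm p q))

term≤∑ : ∀ {n} {v : Fin n → ℚ} → (∀ a → 0ℚ ≤ v a) → ∀ a → v a ≤ ∑ v
term≤∑ 0≤v zero    = p≤p+q (∑-nonneg (0≤v ∘ suc))
term≤∑ 0≤v (suc a) = ≤-trans (term≤∑ (0≤v ∘ suc) a) (p≤q+p (0≤v zero))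

∑-mono-< : ∀ {n} {v w : Fin (suc n) → ℚ} → (∀ a → v a < w a) → ∑ v < ∑ w
∑-mono-< v<w = +-mono-<-≤ (v<w zero) (∑-mono-≤ (<⇒≤ ∘ v<w ∘ suc))

-- A family of average at most b has a member which is at most b.
∃-below-average : ∀ {n} .{{_ : NonZero n}} (v : Fin n → ℚ) b →
                  ∑ v ≤ ∑ {n} (const b) → ∃ λ a → v a ≤ b
∃-below-average {suc n} v b ∑v≤ with Fin.any? (λ a → v a ≤? b)
... | yes va≤b = va≤b
... | no  va≰b = contradiction (<-≤-trans (∑-mono-< λ a → ≰⇒> (λ va≤b → va≰b (a , va≤b))) ∑v≤)
                               (<-irrefl refl)

-- The number m, as a rational.
card : ℕ → ℚ
card m = ∑ {m} (const 1ℚ)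

∑-const : ∀ m p → ∑ {m} (const p) ≡ card m * p
∑-const m p = begin
  ∑ {m} (const p)         ≡⟨ sum-cong-≗ {m} (λ _ → *-identityˡ p) ⟨
  ∑ {m} (const (1ℚ * p))  ≡⟨ *-distribʳ-sum p (const {B = Fin m} 1ℚ) ⟨
  card m * p              ∎
  where open ≡-Reasoning

0≤card : ∀ m → 0ℚ ≤ card m
0≤card m = ∑-nonneg {m} (λ _ → nonNegative⁻¹ 1ℚ)

1/[m*n] : ∀ m n .{{_ : NonZero m}} .{{_ : NonZero n}} .{{_ : NonZero (m ℕ.* n)}} →
          1ℤ / (m ℕ.* n) ≡ (1ℤ / m) * (1ℤ / n)
1/[m*n] m@(suc m′) n@(suc n′) = toℚᵘ-injective (begin-equality
  toℚᵘ (1ℤ / (m ℕ.* n))                 ≃⟨ toℚᵘ-fromℚᵘ (1ℤ ℚᵘ./ (m ℕ.* n)) ⟩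
  (1ℤ ℚᵘ./ m) ℚᵘ.* (1ℤ ℚᵘ./ n)          ≃⟨ ℚᵘ.*-cong (toℚᵘ-fromℚᵘ (1ℤ ℚᵘ./ m)) (toℚᵘ-fromℚᵘ (1ℤ ℚᵘ./ n)) ⟨
  toℚᵘ (1ℤ / m) ℚᵘ.* toℚᵘ (1ℤ / n)      ≃⟨ toℚᵘ-homo-* (1ℤ / m) (1ℤ / n) ⟨
  toℚᵘ ((1ℤ / m) * (1ℤ / n))            ∎)
  where
  open ℚᵘ.≤-Reasoning

card-ℤ : ∀ m → card m ≡ + m / 1
card-ℤ zero = refl
card-ℤ (suc m) = trans (cong (λ p → 1ℚ + p) (card-ℤ m)) (toℚᵘ-injective (begin-equality
  toℚᵘ (1ℚ + + m / 1)             ≃⟨ toℚᵘ-homo-+ 1ℚ (+ m / 1) ⟩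
  toℚᵘ 1ℚ ℚᵘ.+ toℚᵘ (+ m / 1)     ≃⟨ ℚᵘ.+-congʳ (toℚᵘ 1ℚ) (toℚᵘ-fromℚᵘ (+ m ℚᵘ./ 1)) ⟩
  (1ℤ ℚᵘ./ 1) ℚᵘ.+ (+ m ℚᵘ./ 1)   ≡⟨ cong (ℚᵘ._/ 1) (cong (λ i → + 1 +ᶻ i) (ℤ.*-identityʳ (+ m))) ⟩
  + suc m ℚᵘ./ 1                  ≃⟨ toℚᵘ-fromℚᵘ (+ suc m ℚᵘ./ 1) ⟨
  toℚᵘ (+ suc m / 1)              ∎))
  where
  open ℚᵘ.≤-Reasoning

card*1/m : ∀ m .{{_ : NonZero m}} → card m * (1ℤ / m) ≡ 1ℚ
card*1/m m@(suc m′) = trans (cong (_* (1ℤ / m)) (card-ℤ m)) (toℚᵘ-injective (begin-equality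
  toℚᵘ ((+ m / 1) * (1ℤ / m))          ≃⟨ toℚᵘ-homo-* (+ m / 1) (1ℤ / m) ⟩
  toℚᵘ (+ m / 1) ℚᵘ.* toℚᵘ (1ℤ / m)    ≃⟨ ℚᵘ.*-cong (toℚᵘ-fromℚᵘ (+ m ℚᵘ./ 1)) (toℚᵘ-fromℚᵘ (1ℤ ℚᵘ./ m)) ⟩
  (+ m ℚᵘ./ 1) ℚᵘ.* (1ℤ ℚᵘ./ m)        ≃⟨ ℚᵘ.*≡* (trans (ℤ.*-identityʳ (+ m *ᶻ 1ℤ)) (trans (ℤ.*-identityʳ (+ m)) (sym (trans (ℤ.*-identityˡ _) (cong +_ (ℕ.*-identityˡ m)))))) ⟩
  toℚᵘ 1ℚ                              ∎))
  where
  open ℚᵘ.≤-Reasoning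

0<1/m : ∀ m .{{_ : NonZero m}} → 0ℚ < 1ℤ / m
0<1/m m = positive⁻¹ (1ℤ / m) {{normalize-pos 1 m}}

-- Partial sums

partialSum-mono-≤ : ∀ {g h : ℕ → ℚ} → (∀ k → g k ≤ h k) → ∀ k → partialSum g k ≤ partialSum h k
partialSum-mono-≤ g≤h zero    = ≤-refl
partialSum-mono-≤ g≤h (suc k) = +-mono-≤ (partialSum-mono-≤ g≤h k) (g≤h k)

partialSum-nonneg : ∀ {g : ℕ → ℚ} → (∀ k → 0ℚ ≤ g k) → ∀ k → 0ℚ ≤ partialSum g k
partialSum-nonneg 0≤g zero    = ≤-refl
partialSum-nonneg 0≤g (suc k) = +-mono-≤ (partialSum-nonneg 0≤g k) (0≤g k)

partialSum-*ˡ : ∀ M (g : ℕ → ℚ) k → partialSum (λ i → M * g i) k ≡ M * partialSum g k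
partialSum-*ˡ M g zero    = sym (*-zeroʳ M)
partialSum-*ˡ M g (suc k) =
  trans (cong (_+ M * g k) (partialSum-*ˡ M g k)) (sym (*-distribˡ-+ M (partialSum g k) (g k)))

partialSum-dominated : ∀ {g h : ℕ → ℚ} M → (∀ k → h k ≤ M * g k) →
                       ∀ k → partialSum h k ≤ M * partialSum g k
partialSum-dominated {g} M h≤Mg k =
  ≤-trans (partialSum-mono-≤ h≤Mg k) (≤-reflexive (partialSum-*ˡ M g k))

partialSum-∑ : ∀ {n} (h : Fin n → ℕ → ℚ) k →
               ∑ (λ a → partialSum (h a) k) ≡ partialSum (λ i → ∑ (λ a → h a i)) k
partialSum-∑ {n} h zero    = trans (∑-const n 0ℚ) (*-zeroʳ (card n))
partialSum-∑     h (suc k) = trans (∑-distrib-+ (λ a → partialSum (h a) k) (λ a → h a k))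
                                   (cong (_+ ∑ (λ a → h a k)) (partialSum-∑ h k))

-- The sum of k terms from index N on.
tailSum : (ℕ → ℚ) → ℕ → ℕ → ℚ
tailSum g N = partialSum (λ i → g (i ℕ.+ N))

partialSum-split : ∀ g N k → partialSum g (k ℕ.+ N) ≡ partialSum g N + tailSum g N k
partialSum-split g N zero    = sym (+-identityʳ (partialSum g N))
partialSum-split g N (suc k) =
  trans (cong (_+ g (k ℕ.+ N)) (partialSum-split g N k))
        (+-assoc (partialSum g N) (tailSum g N k) (g (k ℕ.+ N)))

-- For nonnegative g, this says that the partial sums of g are Cauchy.
SmallTails : (ℕ → ℚ) → Set
SmallTails g = ∀ δ → 0ℚ < δ → ∃ λ N → ∀ k → tailSum g N k ≤ δ

p≤∣p∣ : ∀ p → p ≤ ∣ p ∣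
p≤∣p∣ p with ≤-total 0ℚ p
... | inj₁ 0≤p = ≤-reflexive (sym (0≤p⇒∣p∣≡p 0≤p))
... | inj₂ p≤0 = ≤-trans p≤0 (0≤∣p∣ p)

Cauchy⇒SmallTails : ∀ g → Cauchy (partialSum g) → SmallTails g
Cauchy⇒SmallTails g cauchy δ 0<δ = let N , close = cauchy δ 0<δ in N , λ k → begin
  tailSum g N k                                        ≡⟨ solve 2 (λ S T → T := (S :+ T) :- S) refl (partialSum g N) (tailSum g N k) ⟩
  (partialSum g N + tailSum g N k) - partialSum g N    ≡⟨ cong (_- partialSum g N) (partialSum-split g N k) ⟨
  partialSum g (k ℕ.+ N) - partialSum g N              ≤⟨ p≤∣p∣ _ ⟩
  ∣ partialSum g (k ℕ.+ N) - partialSum g N ∣          ≤⟨ close (k ℕ.+ N) N (ℕ.m≤n+m N k) ℕ.≤-refl ⟩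
  δ                                                    ∎
  where
  open ≤-Reasoning
  open +-*-Solver

-- One index N serves all the sequences h dominated by M * g; it is the index
-- at which the tails of g are at most p * δ, where p is the inverse of M.
tailSum-dominated : ∀ {g : ℕ → ℚ} {M p} → 0ℚ ≤ M → 0ℚ < p → M * p ≡ 1ℚ → SmallTails g →
                    ∀ δ → 0ℚ < δ →
                    ∃ λ N → ∀ (h : ℕ → ℚ) → (∀ k → h k ≤ M * g k) → ∀ k → tailSum h N k ≤ δ
tailSum-dominated {g} {M} {p} 0≤M 0<p Mp≡1 small δ 0<δ =
  let N , small-N = small (p * δ) (positive⁻¹ (p * δ) {{pos*pos⇒pos p {{positive 0<p}} δ {{positive 0<δ}}}})
  in N , λ h h≤Mg k → begin
    tailSum h N k      ≤⟨ partialSum-dominated M (λ i → h≤Mg (i ℕ.+ N)) k ⟩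
    M * tailSum g N k  ≤⟨ *-monoˡ-≤-nonNeg M {{nonNegative 0≤M}} (small-N k) ⟩
    M * (p * δ)        ≡⟨ *-assoc M p δ ⟨
    M * p * δ          ≡⟨ cong (_* δ) Mp≡1 ⟩
    1ℚ * δ             ≡⟨ *-identityˡ δ ⟩
    δ                  ∎
  where open ≤-Reasoning

-- The sequence g is summable, with sum strictly below 1.
record Light (g : ℕ → ℚ) : Set where
  field
    smallTails : SmallTails g
    bound      : ℚ
    bound<1    : bound < 1ℚ
    sums≤bound : ∀ k → partialSum g k ≤ bound

-- If g is the average of the h a and is light, then one of the h a is light.
-- The choice of a is effective: it only looks at partial sums up to an index
-- N beyond which every h a adds less than the available slack.
Light-branch : ∀ {m} .{{_ : NonZero m}} (g : ℕ → ℚ) (h : Fin m → ℕ → ℚ) →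
               (∀ a k → 0ℚ ≤ h a k) → (∀ k → ∑ (λ a → h a k) ≡ ∑ {m} (λ _ → g k)) →
               Light g → ∃ λ a → Light (h a)
Light-branch {m} g h 0≤h average g-light = a , record
  { smallTails = λ δ 0<δ → let N′ , small = uniformTails δ 0<δ in N′ , small (h a) (h≤card*g a)
  ; bound      = bound′
  ; bound<1    = bound′<1
  ; sums≤bound = sums≤bound′
  }
  where
  open Light g-light

  uniformTails = tailSum-dominated {g} {M = card m} (0≤card m) (0<1/m m) (card*1/m m) smallTails

  h≤card*g : ∀ a k → h a k ≤ card m * g k
  h≤card*g a k = begin
    h a k               ≤⟨ term≤∑ (λ b → 0≤h b k) a ⟩
    ∑ (λ b → h b k)     ≡⟨ average k ⟩
    ∑ {m} (λ _ → g k)   ≡⟨ ∑-const m (g k) ⟩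
    card m * g k        ∎
    where open ≤-Reasoning

  bound′       = proj₁ (<-dense bound<1)
  bound<bound′ = proj₁ (proj₂ (<-dense bound<1))
  bound′<1     = proj₂ (proj₂ (<-dense bound<1))

  slack = bound′ - bound

  0<slack : 0ℚ < slack
  0<slack = begin-strict
    0ℚ              ≡⟨ +-inverseʳ bound ⟨
    bound - bound   <⟨ +-monoˡ-< (- bound) bound<bound′ ⟩
    slack           ∎
    where open ≤-Reasoning

  N = proj₁ (uniformTails slack 0<slack)

  below-average : ∃ λ a → partialSum (h a) N ≤ bound
  below-average = ∃-below-average (λ a → partialSum (h a) N) bound (begin
    ∑ (λ a → partialSum (h a) N)             ≡⟨ partialSum-∑ h N ⟩
    partialSum (λ i → ∑ (λ a → h a i)) N     ≤⟨ partialSum-mono-≤ (λ k → ≤-reflexive (average k)) N ⟩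
    partialSum (λ i → ∑ {m} (λ _ → g i)) N   ≡⟨ partialSum-∑ {m} (λ _ → g) N ⟨
    ∑ {m} (λ _ → partialSum g N)             ≤⟨ ∑-mono-≤ {m} (λ _ → sums≤bound N) ⟩
    ∑ {m} (const bound)                      ∎)
    where open ≤-Reasoning

  a = proj₁ below-average

  sums≤bound′ : ∀ k → partialSum (h a) k ≤ bound′
  sums≤bound′ k = begin
    partialSum (h a) k                       ≤⟨ p≤p+q (partialSum-nonneg (λ i → 0≤h a (i ℕ.+ k)) N) ⟩
    partialSum (h a) k + tailSum (h a) k N   ≡⟨ partialSum-split (h a) k N ⟨
    partialSum (h a) (N ℕ.+ k)               ≡⟨ cong (partialSum (h a)) (ℕ.+-comm N k) ⟩
    partialSum (h a) (k ℕ.+ N)               ≡⟨ partialSum-split (h a) N k ⟩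
    partialSum (h a) N + tailSum (h a) N k   ≤⟨ +-mono-≤ (proj₂ below-average)
                                                  (proj₂ (uniformTails slack 0<slack) (h a) (h≤card*g a) k) ⟩
    bound + (bound′ - bound)                 ≡⟨ solve 2 (λ b b′ → b :+ (b′ :- b) := b′) refl bound bound′ ⟩
    bound′                                   ∎
    where
    open ≤-Reasoning
    open +-*-Solver

-- Updates and partial assignments

-- The function g with its value at z replaced by x.
_[_↦_] : {X : Set} → (ℤ → X) → ℤ → X → ℤ → X
(g [ z ↦ x ]) y = if does (y ≟ᶻ z) then x else g y

update-same : ∀ {X : Set} (g : ℤ → X) z {x} → (g [ z ↦ x ]) z ≡ x
update-same g z rewrite dec-true (z ≟ᶻ z) refl = refl

update-other : ∀ {X : Set} (g : ℤ → X) {y z x} → y ≢ z → (g [ z ↦ x ]) y ≡ g y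
update-other g {y} {z} y≢z rewrite dec-false (y ≟ᶻ z) y≢z = refl

-- A partial assignment of symbols to cells; the cells z with A z ≡ nothing are
-- unassigned.
Partial : Set → Set
Partial X = ℤ → Maybe X

-- B extends A.
_⊑_ : {X : Set} → Partial X → Partial X → Set
A ⊑ B = ∀ z a → A z ≡ just a → B z ≡ just a

⊑-update : ∀ {X : Set} {A : Partial X} {z x} → A z ≡ nothing → A ⊑ (A [ z ↦ x ])
⊑-update {z = z} Az y a Ay with y ≟ᶻ z
... | yes refl with () ← trans (sym Az) Ay
... | no  _    = Ay

update-satisfies : ∀ {X : Set} (A : Partial X) (s : ℤ → X) {z x} (C : List (ℤ × X)) →
                   All (λ y → A y ≡ just (s y)) (map proj₁ C) →
                   All (λ (y , c) → (s [ z ↦ x ]) y ≡ c) C →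
                   All (λ (y , c) → (A [ z ↦ just x ]) y ≡ just c) C
update-satisfies A s             []            []         []         = []
update-satisfies A s {z} {x} ((y , c) ∷ C) (Ay ∷ A≡s) (sy ∷ s∈C) = at-y ∷ update-satisfies A s C A≡s s∈C
  where
  at-y : (A [ z ↦ just x ]) y ≡ just c
  at-y with does (y ≟ᶻ z)
  ... | true  = cong just sy
  ... | false = trans Ay (cong just sy)

-- If every partial assignment with property P can be extended at any given
-- cell without losing P, then there is a total s such that on any finite set
-- of cells, s agrees with some partial assignment with property P.
complete : ∀ {X : Set} (P : Partial X → Set) →
           (∀ z A → P A → ∃ λ B → P B × A ⊑ B × ∃ λ a → B z ≡ just a) →
           ∃ P →
           ∃ λ (s : ℤ → X) → ∀ L → ∃ λ A → P A × All (λ z → A z ≡ just (s z)) L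
complete {X} P extend start = s , λ L →
  let n , agree = agreement L in assignment n , proj₂ (stage n) , agree
  where
  -- One stage handles the cells n and -(1+n).
  next : ℕ → ∃ P → ∃ P
  next n (A , PA) = let B , PB , _ = extend (+ n) A PA
                        C , PC , _ = extend -[1+ n ] B PB
                    in C , PC

  stage : ℕ → ∃ P
  stage zero    = start
  stage (suc n) = next n (stage n)

  assignment : ℕ → Partial X
  assignment n = proj₁ (stage n)

  grows : ∀ n → assignment n ⊑ assignment (suc n)
  grows n z a eq = let B , PB , A⊑B , _ = extend (+ n) (assignment n) (proj₂ (stage n))
                       _ , _  , B⊑C , _ = extend -[1+ n ] B PB
                   in B⊑C z a (A⊑B z a eq)

  mono′ : ∀ {i j} → i ℕ.≤′ j → assignment i ⊑ assignment j
  mono′ ℕ.≤′-refl       z a eq = eq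
  mono′ (ℕ.≤′-step i≤j) z a eq = grows _ z a (mono′ i≤j z a eq)

  mono : ∀ {i j} → i ℕ.≤ j → assignment i ⊑ assignment j
  mono i≤j = mono′ (ℕ.≤⇒≤′ i≤j)

  -- A stage at which the cell has been handled.
  index : ℤ → ℕ
  index (+ n)    = suc n
  index -[1+ n ] = suc n

  assigned : ∀ z → ∃ λ a → assignment (index z) z ≡ just a
  assigned (+ n)    = let B , PB , _ , a , eq  = extend (+ n) (assignment n) (proj₂ (stage n))
                          _ , _  , B⊑C , _     = extend -[1+ n ] B PB
                      in a , B⊑C (+ n) a eq
  assigned -[1+ n ] = let B , PB , _          = extend (+ n) (assignment n) (proj₂ (stage n))
                          _ , _  , _ , a , eq = extend -[1+ n ] B PB
                      in a , eq

  s : ℤ → X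
  s z = proj₁ (assigned z)

  -- The stages being increasing, the last of the indices of L will do.
  agreement : ∀ L → ∃ λ n → All (λ z → assignment n z ≡ just (s z)) L
  agreement []      = zero , []
  agreement (z ∷ L) = let n , agree = agreement L in
    index z ℕ.⊔ n
    , mono (ℕ.m≤m⊔n (index z) n) z (s z) (proj₂ (assigned z))
    ∷ All.map (λ {y} → mono (ℕ.m≤n⊔m (index z) n) y (s y)) agree

-- Conditional measure of cylinders

-- The probability that a cell of content A z carries the symbol a, an
-- unassigned cell being uniform.
cellWeight : ∀ {m} .{{_ : NonZero m}} → Maybe (Fin m) → Fin m → ℚ
cellWeight {m} nothing  a = 1ℤ / m
cellWeight     (just b) a = if does (b Fin.≟ a) then 1ℚ else 0ℚ

-- The conditional measure, given the partial assignment A, of the set of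
-- configurations that satisfy the constraints on (distinct) cells.
weight : ∀ {m} .{{_ : NonZero m}} → Partial (Fin m) → List (ℤ × Fin m) → ℚ
weight A []            = 1ℚ
weight A ((z , a) ∷ C) = cellWeight (A z) a * weight A C

0≤p*q : ∀ {p q} → 0ℚ ≤ p → 0ℚ ≤ q → 0ℚ ≤ p * q
0≤p*q {p} {q} 0≤p 0≤q =
  nonNegative⁻¹ (p * q) {{nonNeg*nonNeg⇒nonNeg p {{nonNegative 0≤p}} q {{nonNegative 0≤q}}}}

0≤cellWeight : ∀ {m} .{{_ : NonZero m}} (x : Maybe (Fin m)) a → 0ℚ ≤ cellWeight x a
0≤cellWeight {m} nothing  a = <⇒≤ (0<1/m m)
0≤cellWeight     (just b) a with does (b Fin.≟ a)
... | true  = nonNegative⁻¹ 1ℚ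
... | false = ≤-refl

0≤weight : ∀ {m} .{{_ : NonZero m}} (A : Partial (Fin m)) C → 0ℚ ≤ weight A C
0≤weight A []            = nonNegative⁻¹ 1ℚ
0≤weight A ((z , a) ∷ C) = 0≤p*q (0≤cellWeight (A z) a) (0≤weight A C)

weight-unassigned : ∀ {m} .{{_ : NonZero m}} (C : Cylinder m) →
                    weight (const nothing) (Cylinder.constraints C) ≡ μ C
weight-unassigned {m} C = go (Cylinder.constraints C)
  where
  go : ∀ L → weight (const nothing) L ≡ _/_ 1ℤ (m ^ length L) {{ℕ.m^n≢0 m (length L)}}
  go []      = refl
  go (_ ∷ L) = trans (cong (1ℤ / m *_) (go L))
    (sym (1/[m*n] m (m ^ length L) {{it}} {{ℕ.m^n≢0 m (length L)}} {{ℕ.m^n≢0 m (suc (length L))}}))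

weight-satisfied : ∀ {m} .{{_ : NonZero m}} (A : Partial (Fin m)) {C} →
                   All (λ (z , a) → A z ≡ just a) C → weight A C ≡ 1ℚ
weight-satisfied A                     []         = refl
weight-satisfied A {C = (z , a) ∷ C} (Az≡a ∷ sat)
  rewrite Az≡a | dec-true (a Fin.≟ a) refl | weight-satisfied A sat = refl

weight-cong : ∀ {m} .{{_ : NonZero m}} {A B : Partial (Fin m)} {C} →
              All (λ z → A z ≡ B z) (map proj₁ C) → weight A C ≡ weight B C
weight-cong {C = []}          []         = refl
weight-cong {C = (z , a) ∷ C} (eq ∷ eqs) = cong₂ _*_ (cong (λ x → cellWeight x a) eq) (weight-cong eqs)

∑-indicator : ∀ {m} .{{_ : NonZero m}} (a : Fin m) → ∑ (λ b → cellWeight (just b) a) ≡ 1ℚ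
∑-indicator {m} a = go a
  where
  go : ∀ {n} (a : Fin n) → ∑ (λ b → if does (b Fin.≟ a) then 1ℚ else 0ℚ) ≡ 1ℚ
  go {suc n} zero    = cong (λ p → 1ℚ + p) (trans (∑-const n 0ℚ) (*-zeroʳ (card n)))
  go {suc n} (suc a) = trans (+-identityˡ _) (go a)

-- The law of total probability: weights are averages over the symbols at an
-- unassigned cell z.
weight-average : ∀ {m} .{{_ : NonZero m}} {A : Partial (Fin m)} {B : Fin m → Partial (Fin m)} {z} →
                 A z ≡ nothing → (∀ b → B b z ≡ just b) → (∀ b {y} → y ≢ z → B b y ≡ A y) →
                 ∀ {C} → Unique (map proj₁ C) →
                 ∑ (λ b → weight (B b) C) ≡ ∑ {m} (λ _ → weight A C)
weight-average                 Az Bz B≡A {C = []}          _              = refl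
weight-average {m} {A} {B} {z} Az Bz B≡A {C = (y , a) ∷ C} (y∉C ∷ unique) with y ≟ᶻ z
... | yes refl = begin
  ∑ (λ b → cellWeight (B b z) a * weight (B b) C)    ≡⟨ sum-cong-≗ (λ b → cong₂ (λ x w → cellWeight x a * w) (Bz b) (weight-cong {C = C} (All.map (λ z≢y → B≡A b (z≢y ∘ sym)) y∉C))) ⟩
  ∑ (λ b → cellWeight (just b) a * weight A C)       ≡⟨ *-distribʳ-sum (weight A C) (λ b → cellWeight (just b) a) ⟨
  ∑ (λ b → cellWeight (just b) a) * weight A C       ≡⟨ cong (_* weight A C) (trans (∑-indicator a) (sym (trans (∑-const m (1ℤ / m)) (card*1/m m)))) ⟩
  ∑ {m} (λ _ → cellWeight nothing a) * weight A C    ≡⟨ *-distribʳ-sum (weight A C) (λ (_ : Fin m) → cellWeight nothing a) ⟩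
  ∑ {m} (λ _ → cellWeight nothing a * weight A C)    ≡⟨ cong (λ x → ∑ {m} (λ _ → cellWeight x a * weight A C)) Az ⟨
  ∑ {m} (λ _ → cellWeight (A z) a * weight A C)      ∎
  where open ≡-Reasoning
... | no y≢z = begin
  ∑ (λ b → cellWeight (B b y) a * weight (B b) C)    ≡⟨ sum-cong-≗ (λ b → cong (λ x → cellWeight x a * weight (B b) C) (B≡A b y≢z)) ⟩
  ∑ (λ b → cellWeight (A y) a * weight (B b) C)      ≡⟨ *-distribˡ-sum (cellWeight (A y) a) (λ b → weight (B b) C) ⟨
  cellWeight (A y) a * ∑ (λ b → weight (B b) C)      ≡⟨ cong (cellWeight (A y) a *_) (weight-average Az Bz B≡A unique) ⟩
  cellWeight (A y) a * ∑ {m} (λ _ → weight A C)      ≡⟨ *-distribˡ-sum (cellWeight (A y) a) (λ (_ : Fin m) → weight A C) ⟩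
  ∑ {m} (λ _ → cellWeight (A y) a * weight A C)      ∎
  where open ≡-Reasoning

-- The weight of an entry of a cover; nothing stands for the empty set.
weight? : ∀ {m} .{{_ : NonZero m}} → Partial (Fin m) → Maybe (Cylinder m) → ℚ
weight? A = maybe′ (weight A ∘ Cylinder.constraints) 0ℚ

0≤weight? : ∀ {m} .{{_ : NonZero m}} (A : Partial (Fin m)) C → 0ℚ ≤ weight? A C
0≤weight? A nothing  = ≤-refl
0≤weight? A (just C) = 0≤weight A (Cylinder.constraints C)

weight?-unassigned : ∀ {m} .{{_ : NonZero m}} (C : Maybe (Cylinder m)) →
                     weight? (const nothing) C ≡ maybe′ μ 0ℚ C
weight?-unassigned nothing  = refl
weight?-unassigned (just C) = weight-unassigned C

weight?-average : ∀ {m} .{{_ : NonZero m}} {A : Partial (Fin m)} {B : Fin m → Partial (Fin m)} {z} →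
                  A z ≡ nothing → (∀ b → B b z ≡ just b) → (∀ b {y} → y ≢ z → B b y ≡ A y) →
                  ∀ C → ∑ (λ b → weight? (B b) C) ≡ ∑ {m} (λ _ → weight? A C)
weight?-average Az Bz B≡A nothing  = refl
weight?-average Az Bz B≡A (just C) = weight-average Az Bz B≡A (Cylinder.distinct C)

-- Configurations outside a null set

term≤partialSum : ∀ {g : ℕ → ℚ} → (∀ k → 0ℚ ≤ g k) → ∀ k → g k ≤ partialSum g (suc k)
term≤partialSum 0≤g k = p≤q+p (partialSum-nonneg 0≤g k)

-- Outside a null set there is a pair of configurations that differ at most at
-- z₀, with prescribed symbols a and b there.
Null-avoid : ∀ {m} .{{_ : NonZero m}} {E : Pred (Config m) 0ℓ} → Null E →
             ∀ z₀ a b → ∃ λ s → ¬ E (s [ z₀ ↦ a ]) × ¬ E (s [ z₀ ↦ b ])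
Null-avoid {m} {E} null z₀ a b =
  s
  , avoids a (λ A k → p≤p+q (0≤weight? (A [ z₀ ↦ just b ]) (U k)))
  , avoids b (λ A k → p≤q+p (0≤weight? (A [ z₀ ↦ just a ]) (U k)))
  where
  -- M bounds the increase in measure, a factor m for each of a and b; p is its
  -- inverse, and the cover is chosen with M * ε equal to 1/2.
  M p ε : ℚ
  M = card m + card m
  p = (1ℤ / m) * ½
  ε = p * ½

  0≤M : 0ℚ ≤ M
  0≤M = +-mono-≤ (0≤card m) (0≤card m)

  0<p : 0ℚ < p
  0<p = positive⁻¹ p {{pos*pos⇒pos (1ℤ / m) {{positive (0<1/m m)}} ½}}

  0<ε : 0ℚ < ε
  0<ε = positive⁻¹ ε {{pos*pos⇒pos p {{positive 0<p}} ½}}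

  M*p≡1 : M * p ≡ 1ℚ
  M*p≡1 = trans (solve 2 (λ c i → (c :+ c) :* (i :* con ½) := c :* i) refl (card m) (1ℤ / m)) (card*1/m m)
    where open +-*-Solver

  U      = proj₁ (null ε 0<ε)
  cauchy = proj₁ (proj₂ (null ε 0<ε))
  sums≤ε = proj₁ (proj₂ (proj₂ (null ε 0<ε)))
  covers = proj₂ (proj₂ (proj₂ (null ε 0<ε)))

  -- The weights of the two conditions that s [ z₀ ↦ a ], respectively
  -- s [ z₀ ↦ b ], lies in U k.
  pairWeight : Partial (Fin m) → ℕ → ℚ
  pairWeight A k = weight? (A [ z₀ ↦ just a ]) (U k) + weight? (A [ z₀ ↦ just b ]) (U k)

  0≤pairWeight : ∀ A k → 0ℚ ≤ pairWeight A k
  0≤pairWeight A k = +-mono-≤ (0≤weight? (A [ z₀ ↦ just a ]) (U k)) (0≤weight? (A [ z₀ ↦ just b ]) (U k))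

  -- The content of z₀ is overridden in pairWeight.  That z₀ counts as
  -- assigned keeps it from being assigned later.
  Good : Partial (Fin m) → Set
  Good A = (∃ λ x → A z₀ ≡ just x) × Light (pairWeight A)

  A₀ : Partial (Fin m)
  A₀ = const nothing [ z₀ ↦ just a ]

  -- Prescribing one symbol multiplies measures by at most m.
  weight-A₀ : ∀ x k → weight? (A₀ [ z₀ ↦ just x ]) (U k) ≤ card m * maybe′ μ 0ℚ (U k)
  weight-A₀ x k = begin
    weight? (A₀ [ z₀ ↦ just x ]) (U k)                ≤⟨ term≤∑ (λ c → 0≤weight? (A₀ [ z₀ ↦ just c ]) (U k)) x ⟩
    ∑ (λ c → weight? (A₀ [ z₀ ↦ just c ]) (U k))      ≡⟨ weight?-average {A = const nothing} {z = z₀} refl (λ c → update-same A₀ z₀)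
                                                           (λ c y≢z₀ → trans (update-other A₀ y≢z₀) (update-other (const nothing) y≢z₀)) (U k) ⟩
    ∑ {m} (λ _ → weight? (const nothing) (U k))       ≡⟨ ∑-const m (weight? (const nothing) (U k)) ⟩
    card m * weight? (const nothing) (U k)            ≡⟨ cong (card m *_) (weight?-unassigned (U k)) ⟩
    card m * maybe′ μ 0ℚ (U k)                        ∎
    where open ≤-Reasoning

  pairWeight-A₀ : ∀ k → pairWeight A₀ k ≤ M * maybe′ μ 0ℚ (U k)
  pairWeight-A₀ k = ≤-trans (+-mono-≤ (weight-A₀ a k) (weight-A₀ b k))
    (≤-reflexive (sym (*-distribʳ-+ (maybe′ μ 0ℚ (U k)) (card m) (card m))))

  start : ∃ Good
  start = A₀ , (a , update-same (const nothing) z₀) , record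
    { smallTails = λ δ 0<δ →
        let N , small = tailSum-dominated 0≤M 0<p M*p≡1
                          (Cauchy⇒SmallTails (maybe′ μ 0ℚ ∘ U) cauchy) δ 0<δ
        in N , small (pairWeight A₀) pairWeight-A₀
    ; bound      = ½
    ; bound<1    = ½<1
    ; sums≤bound = λ k → begin
        partialSum (pairWeight A₀) k           ≤⟨ partialSum-dominated M pairWeight-A₀ k ⟩
        M * partialSum (maybe′ μ 0ℚ ∘ U) k     ≤⟨ *-monoˡ-≤-nonNeg M {{nonNegative 0≤M}} (sums≤ε k) ⟩
        M * (p * ½)                            ≡⟨ *-assoc M p ½ ⟨
        M * p * ½                              ≡⟨ cong (_* ½) M*p≡1 ⟩
        1ℚ * ½                                 ≡⟨ *-identityˡ ½ ⟩
        ½                                      ∎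
    }
    where
    open ≤-Reasoning
    ½<1 : ½ < 1ℚ
    ½<1 = +-monoʳ-< ½ (positive⁻¹ ½)

  pairWeight-average : ∀ {z A} → A z ≡ nothing → z ≢ z₀ → ∀ k →
                       ∑ (λ c → pairWeight (A [ z ↦ just c ]) k) ≡ ∑ {m} (λ _ → pairWeight A k)
  pairWeight-average {z} {A} Az z≢z₀ k = begin
    ∑ (λ c → pairWeight (A [ z ↦ just c ]) k)                          ≡⟨ ∑-distrib-+ (w a) (w b) ⟩
    ∑ (w a) + ∑ (w b)                                                  ≡⟨ cong₂ _+_ (average a) (average b) ⟩
    ∑ (v a) + ∑ (v b)                                                  ≡⟨ ∑-distrib-+ (v a) (v b) ⟨
    ∑ {m} (λ _ → pairWeight A k)                                       ∎
    where
    open ≡-Reasoning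

    w v : Fin m → Fin m → ℚ
    w x c = weight? ((A [ z ↦ just c ]) [ z₀ ↦ just x ]) (U k)
    v x _ = weight? (A [ z₀ ↦ just x ]) (U k)

    elsewhere : ∀ x c {y} → y ≢ z → ((A [ z ↦ just c ]) [ z₀ ↦ just x ]) y ≡ (A [ z₀ ↦ just x ]) y
    elsewhere x c {y} y≢z with does (y ≟ᶻ z₀)
    ... | true  = refl
    ... | false = update-other A y≢z

    average : ∀ x → ∑ (w x) ≡ ∑ (v x)
    average x = weight?-average (trans (update-other A z≢z₀) Az)
      (λ c → trans (update-other (A [ z ↦ just c ]) z≢z₀) (update-same A z)) (elsewhere x) (U k)

  extend : ∀ z A → Good A → ∃ λ B → Good B × A ⊑ B × ∃ λ c → B z ≡ just c
  extend z A good@((x , Az₀) , lightA) = by-content (A z) refl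
    where
    by-content : ∀ y → A z ≡ y → ∃ λ B → Good B × A ⊑ B × ∃ λ c → B z ≡ just c
    by-content (just c) Az = A , good , (λ _ _ eq → eq) , c , Az
    by-content nothing  Az =
      A [ z ↦ just c ]
      , ((x , trans (update-other A (z≢z₀ ∘ sym)) Az₀) , proj₂ branch)
      , ⊑-update Az
      , c , update-same A z
      where
      z≢z₀ : z ≢ z₀
      z≢z₀ z≡z₀ = contradiction (trans (sym Az₀) (trans (cong A (sym z≡z₀)) Az)) λ ()

      branch = Light-branch (pairWeight A) (λ c → pairWeight (A [ z ↦ just c ]))
                 (λ c → 0≤pairWeight (A [ z ↦ just c ])) (pairWeight-average Az z≢z₀) lightA

      c = proj₁ branch

  completion = complete Good extend start

  s : Config m
  s = proj₁ completion

  -- If s [ z₀ ↦ x ] were in U k, then the weight of U k would be 1 once all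
  -- the cells that it constrains are assigned.
  avoids : ∀ x → (∀ A k → weight? (A [ z₀ ↦ just x ]) (U k) ≤ pairWeight A k) → ¬ E (s [ z₀ ↦ x ])
  avoids x w≤pair s∈E = let k , covered = covers s∈E in uncovered k (U k) refl covered
    where
    uncovered : ∀ k u → U k ≡ u → ¬ Maybe.Any (λ C → ⟦ C ⟧ (s [ z₀ ↦ x ])) u
    uncovered k (just C) Uk (Maybe.just s∈C) = <-irrefl refl (begin-strict
      1ℚ                                        ≡⟨ weight-satisfied (A [ z₀ ↦ just x ]) (update-satisfies A s L A≡s s∈C) ⟨
      weight? (A [ z₀ ↦ just x ]) (just C)      ≡⟨ cong (weight? (A [ z₀ ↦ just x ])) Uk ⟨
      weight? (A [ z₀ ↦ just x ]) (U k)         ≤⟨ w≤pair A k ⟩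
      pairWeight A k                            ≤⟨ term≤partialSum (0≤pairWeight A) k ⟩
      partialSum (pairWeight A) (suc k)         ≤⟨ sums≤bound (suc k) ⟩
      bound                                     <⟨ bound<1 ⟩
      1ℚ                                        ∎)
      where
      open ≤-Reasoning
      L = Cylinder.constraints C
      agreeing = proj₂ completion (map proj₁ L)
      A   = proj₁ agreeing
      A≡s = proj₂ (proj₂ agreeing)
      open Light (proj₂ (proj₁ (proj₂ agreeing)))

-- Totals of finite configurations

sum-filter : ∀ {P : ℤ → Set} (P? : Decidable P) (g : ℤ → ℕ) → (∀ z → ¬ P z → g z ≡ 0) →
             ∀ L → sum (map g (filter P? L)) ≡ sum (map g L)
sum-filter P? g g≡0 []      = refl
sum-filter P? g g≡0 (z ∷ L) with P? z
... | yes _   = cong (g z ℕ.+_) (sum-filter P? g g≡0 L)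
... | no  ¬Pz = trans (sum-filter P? g g≡0 L) (cong (ℕ._+ sum (map g L)) (sym (g≡0 z ¬Pz)))

-- The total does not depend on the list of cells: the cells in a state other
-- than 0 of two such lists are permutations of each other.
total-irrelevant : ∀ {q} {c : Config (suc q)} (fin fin′ : Finite c) → total c fin ≡ total c fin′
total-irrelevant {c = c} (L , unique , support) (L′ , unique′ , support′) = begin
  sum (map g L)                 ≡⟨ sum-filter g≢0? g g≡0 L ⟨
  sum (map g (filter g≢0? L))   ≡⟨ sum-↭ (map⁺ g (∼bag⇒↭ (unique∧set⇒bag
                                     (Unique.filter⁺ g≢0? unique) (Unique.filter⁺ g≢0? unique′)
                                     (mk⇔ (transfer L L′ support′) (transfer L′ L support))))) ⟩
  sum (map g (filter g≢0? L′))  ≡⟨ sum-filter g≢0? g g≡0 L′ ⟩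
  sum (map g L′)                ∎
  where
  open ≡-Reasoning
  g : ℤ → ℕ
  g = toℕ ∘ c

  g≢0? : Decidable (λ z → g z ≢ 0)
  g≢0? z = ¬? (g z ℕ.≟ 0)

  g≡0 : ∀ z → ¬ (g z ≢ 0) → g z ≡ 0
  g≡0 z = decidable-stable (g z ℕ.≟ 0)

  transfer : ∀ L L′ → (∀ z → c z ≢ zero → z ∈ L′) → ∀ {z} → z ∈ filter g≢0? L → z ∈ filter g≢0? L′
  transfer L L′ support′ z∈ = let z∈L , gz≢0 = ∈-filter⁻ g≢0? {xs = L} z∈
    in ∈-filter⁺ g≢0? (support′ _ (λ cz≡0 → gz≢0 (cong toℕ cz≡0))) gz≢0

-- Finite configurations with the same total do not differ in just one cell.
total-determines : ∀ {q} {c c′ : Config (suc q)} (fin : Finite c) (fin′ : Finite c′) z₀ →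
                   (∀ z → z ≢ z₀ → c z ≡ c′ z) → total c fin ≡ total c′ fin′ → c z₀ ≡ c′ z₀
total-determines {c = c} {c′} fin@(L , _ , support) fin′@(L′ , _ , support′) z₀ agree totals≡ =
  Fin.toℕ-injective (ℕ.+-cancelʳ-≡ (sum (map (toℕ ∘ c′) rest)) (toℕ (c z₀)) (toℕ (c′ z₀)) (begin
    toℕ (c z₀) ℕ.+ sum (map (toℕ ∘ c′) rest)    ≡⟨ cong (λ r → toℕ (c z₀) ℕ.+ sum r) (map-cong-local agree-rest) ⟨
    total c finᴷ                                ≡⟨ total-irrelevant finᴷ fin ⟩
    total c fin                                 ≡⟨ totals≡ ⟩
    total c′ fin′                               ≡⟨ total-irrelevant fin′ fin′ᴷ ⟩
    total c′ fin′ᴷ                              ∎))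
  where
  open ≡-Reasoning
  rest = filter (λ y → ¬? (z₀ ≟ᶻ y)) (deduplicate _≟ᶻ_ (L ++ L′))

  -- A common list of cells for both configurations, starting with z₀.
  K = deduplicate _≟ᶻ_ (z₀ ∷ L ++ L′)

  unique : Unique K
  unique = deduplicate-! (z₀ ∷ L ++ L′)

  finᴷ : Finite c
  finᴷ = K , unique , λ z cz≢0 → ∈-deduplicate⁺ _≟ᶻ_ (there (∈-++⁺ˡ (support z cz≢0)))

  fin′ᴷ : Finite c′
  fin′ᴷ = K , unique , λ z cz≢0 → ∈-deduplicate⁺ _≟ᶻ_ (there (∈-++⁺ʳ L (support′ z cz≢0)))

  agree-rest : All (λ z → toℕ (c z) ≡ toℕ (c′ z)) rest
  agree-rest with z₀∉rest ∷ _ ← unique = All.map (λ z₀≢z → cong toℕ (agree _ (z₀≢z ∘ sym))) z₀∉rest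

-- Configurations with a prescribed local pattern

-- The configuration with the entries of x on the cells V and 0 elsewhere.
spread : ∀ {q} (V : List ℤ) → Vec (Fin (suc q)) (length V) → Config (suc q)
spread []      []      = const zero
spread (v ∷ V) (a ∷ x) = spread V x [ v ↦ a ]

spread-support : ∀ {q} V (x : Vec (Fin (suc q)) (length V)) z → spread V x z ≢ zero → z ∈ V
spread-support []      []      z ≢0 = contradiction refl ≢0
spread-support (v ∷ V) (a ∷ x) z ≢0 with z ≟ᶻ v
... | yes z≡v = here z≡v
... | no  _   = there (spread-support V x z ≢0)

map-update : ∀ {X : Set} (g : ℤ → X) {v a V} → All (v ≢_) V →
             mapᵛ (g [ v ↦ a ]) (fromList V) ≡ mapᵛ g (fromList V)
map-update g []            = refl
map-update g (v≢w ∷ v∉V) = cong₂ _∷_ (update-other g (v≢w ∘ sym)) (map-update g v∉V)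

map-spread : ∀ {q V} → Unique V → (x : Vec (Fin (suc q)) (length V)) → mapᵛ (spread V x) (fromList V) ≡ x
map-spread {V = []}    []             []      = refl
map-spread {V = v ∷ V} (v∉V ∷ unique) (a ∷ x) =
  cong₂ _∷_ (update-same (spread V x) v) (trans (map-update (spread V x) v∉V) (map-spread unique x))

-- Conservation forces determinism

lemma5p3 : ∀ (q m : ℕ) .{{_ : NonZero m}} (A : SCA (suc q) m) → IsCFCA A → NumberConserving A → Deterministic A
lemma5p3 q m A@record { V = V ; V-unique = V-unique ; f = f } refl conserving x (a ∷ []) (b ∷ []) =
  decidable-stable (f x (a ∷ []) Fin.≟ f x (b ∷ [])) λ fxa≢fxb →
    ¬¬conserved-a λ (fin-a , total-a) → ¬¬conserved-b λ (fin-b , total-b) →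
      fxa≢fxb (begin
        f x (a ∷ [])    ≡⟨ F-at-0 a ⟨
        image a 0ℤ      ≡⟨ total-determines fin-a fin-b 0ℤ images-agree (trans total-a (sym total-b)) ⟩
        image b 0ℤ      ≡⟨ F-at-0 b ⟩
        f x (b ∷ [])    ∎)
  where
  open ≡-Reasoning

  c : Config (suc q)
  c = spread V x

  fin : Finite c
  fin = V , V-unique , spread-support V x

  avoidance = Null-avoid (conserving c fin) 0ℤ a b
  s = proj₁ avoidance
  ¬¬conserved-a = proj₁ (proj₂ avoidance)
  ¬¬conserved-b = proj₂ (proj₂ avoidance)

  image : Fin m → Config (suc q)
  image r = SCA.F A c (s [ 0ℤ ↦ r ])

  F-at-0 : ∀ r → image r 0ℤ ≡ f x (r ∷ [])
  F-at-0 r = cong (λ y → f y (r ∷ []))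
    (trans (map-cong (λ v → cong c (ℤ.+-identityˡ v)) (fromList V)) (map-spread V-unique x))

  -- Here the automaton being correlation-free matters: cell z only sees the
  -- random symbol at z.
  images-agree : ∀ z → z ≢ 0ℤ → image a z ≡ image b z
  images-agree z z≢0 =
    cong (λ r → f (mapᵛ (λ v → c (z +ᶻ v)) (fromList V)) (r ∷ []))
         (trans (update-other s z+0≢0) (sym (update-other s z+0≢0)))
    where
    z+0≢0 : z +ᶻ 0ℤ ≢ 0ℤ
    z+0≢0 = z≢0 ∘ trans (sym (ℤ.+-identityʳ z))
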